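{- Let $A$ be a set of actions. For every star expression $e\in\mathit{StExp}(A)$, there is a functional bisimulation from the induced chart $\underline{\mathcal{C}}(e)_{(\cdot]}$ of the 1-chart interpretation $\underline{\mathcal{C}}(e)$ of $e$ to the chart interpretation $\mathcal{C}(e)$ of $e$; that is, there is a partial function from the vertices of $\underline{\mathcal{C}}(e)_{(\cdot]}$ to the vertices of $\mathcal{C}(e)$ whose graph is a bisimulation between $\underline{\mathcal{C}}(e)_{(\cdot]}$ and $\mathcal{C}(e)$.
   Context: Star expressions over $A$: the set $\mathit{StExp}(A)$ is given by $e ::= 0 \mid 1 \mid a \mid e_1+e_2 \mid e_1\cdot e_2 \mid e^*$ with $a\in A$ (pure syntax, no identifications). A labeled transition system (LTS) with actions in $A$ is $\langle S,A,\to,\downarrow\rangle$ with $S\neq\emptyset$ a set of states, $\to\subseteq S\times A\times S$, and $\downarrow\subseteq S$ the set of terminating states (written $s\downarrow$). Chart interpretation. Transitions $e\xrightarrow{a}e'$ and termination $e\downarrow$ on $\mathit{StExp}(A)$ are defined inductively by: $1\downarrow$; $(e_1+e_2)\downarrow$ if $e_i\downarrow$ for some $i\in\{1,2\}$; $(e_1\cdot e_2)\downarrow$ if $e_1\downarrow$ and $e_2\downarrow$; $(e^*)\downarrow$; $a\xrightarrow{a}1$; $e_1+e_2\xrightarrow{a}e_i'$ if $e_i\xrightarrow{a}e_i'$ ($i\in\{1,2\}$); $e_1\cdot e_2\xrightarrow{a}e_1'\cdot e_2$ if $e_1\xrightarrow{a}e_1'$; $e_1\cdot e_2\xrightarrow{a}e_2'$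 if $e_1\downarrow$ and $e_2\xrightarrow{a}e_2'$; $e^*\xrightarrow{a}e'\cdot e^*$ if $e\xrightarrow{a}e'$. The chart interpretation $\mathcal{C}(e)$ is the part of this LTS consisting of all star expressions reachable from $e$, with start vertex $e$. Stacked star expressions: the set $\mathit{StExp}^{(\star)}(A)$ is given by $E ::= e \mid E\cdot e \mid E\star e^*$ with $e\in\mathit{StExp}(A)$, where $\star$ is a new binary symbol. Let $1\notin A$ be an additional label (empty step), $\underline{A}=A\cup\{1\}$, with $a$ ranging over $A$ and $\underline{a}$ over $\underline{A}$. Below $e,e_i$ are star expressions and $E,E',E_i,E_i'$ stacked star expressions. Transitions and termination on $\mathit{StExp}^{(\star)}(A)$ are defined inductively by: $1\downarrow$; $(e_1+e_2)\downarrow$ if some $e_i\downarrow$; $(e_1\cdot e_2)\downarrow$ if $e_1\downarrow$ and $e_2\downarrow$; $(e^*)\downarrow$; $a\xrightarrow{a}1$; $e_1+e_2\xrightarrow{a}E_i'$ if $e_i\xrightarrow{a}E_i'$; $E_1\cdot e_2\xrightarrow{\underline{a}}E_1'\cdot e_2$ if $E_1\xrightarrow{\underline{a}}E_1'$; $e_1\cdot e_2\xrightarrow{a}E_2'$ if $e_1\downarrow$ and $e_2\xrightarrow{a}E_2'$; $e^*\xrightarrow{a}E'\star e^*$ if $e\xrightarrow{a}E'$; $E_1\star e_2^*\xrightarrow{\underline{a}}E_1'\star e_2^*$ if $E_1\xrightarrow{\underline{a}}E_1'$; $e_1\star e_2^*\xrightarrow{1}e_2^*$ if $e_1\downarrow$.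 (So expressions of the form $E\star e^*$ never terminate immediately.) The 1-chart interpretation $\underline{\mathcal{C}}(e)$ of $e\in\mathit{StExp}(A)$ is the part of this system consisting of all stacked star expressions reachable from $e$ (via transitions with labels in $\underline{A}$), with start vertex $e$. Induced chart: $\underline{\mathcal{C}}(e)_{(\cdot]}$ has the same vertices and start vertex as $\underline{\mathcal{C}}(e)$; it has an $a$-transition ($a\in A$) from $s$ to $s'$ iff in $\underline{\mathcal{C}}(e)$ there is a path $s=s_0\xrightarrow{1}s_1\xrightarrow{1}\cdots\xrightarrow{1}s_n\xrightarrow{a}s'$ with $n\ge 0$; and $s$ is terminating in it iff in $\underline{\mathcal{C}}(e)$ there is a path $s=s_0\xrightarrow{1}\cdots\xrightarrow{1}s_n$ with $n\ge0$ and $s_n\downarrow$. A bisimulation between two rooted LTSs (charts) with actions in $A$ is a relation $B\subseteq V_1\times V_2$ between their vertex sets that relates the start vertices and such that for all $\langle s_1,s_2\rangle\in B$: (forth) if $s_1\xrightarrow{a}s_1'$ then $s_2\xrightarrow{a}s_2'$ for some $s_2'$ with $\langle s_1',s_2'\rangle\in B$; (back) if $s_2\xrightarrow{a}s_2'$ then $s_1\xrightarrow{a}s_1'$ for some $s_1'$ with $\langle s_1',s_2'\rangle\in B$; (termination) $s_1\downarrow$ iff $s_2\downarrow$. The graph of a partial function $f$ is the set of pairs $\langle v,f(v)\rangle$ with $v$ in the domain of $f$. -}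

module Defs where

open import Level using (Level; suc; _⊔_)
open import Data.Maybe.Base using (Maybe; just; nothing)
open import Data.Product.Base using (∃; Σ-syntax; _×_; _,_)
open import Data.Refinement using (Refinement-syntax; _,_; value)
open import Data.Irrelevant using ([_])
open import Function.Bundles using (_⇔_)
open import Relation.Binary.Core using (Rel; REL)
open import Relation.Binary.Construct.Closure.ReflexiveTransitive using (Star; ε)
open import Relation.Binary.PropositionalEquality.Core using (_≡_)
open import Relation.Unary using (Pred)

private
  variable
    a ℓ : Level
    A   : Set a

------------------------------------------------------------------------
-- Labeled transition systems and charts

record LTS (Act : Set a) : Set (suc a) where
  field
    State      : Set a
    .nonempty  : State
    _-[_]→_    : State → Act → State → Set a
    Terminates : Pred State a

record Chart (Act : Set a) : Set (suc a) where
  field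
    lts   : LTS Act
    start : LTS.State lts
  open LTS lts public

Reachable : {Act : Set a} (L : LTS Act) → Rel (LTS.State L) a
Reachable L = Star (λ s s′ → ∃ λ α → s -[ α ]→ s′)
  where open LTS L

-- Membership proofs in a refinement type are irrelevant, so two vertices
-- are equal (_≡_) precisely when the underlying states are.
reachablePart : {Act : Set a} (L : LTS Act) → LTS.State L → Chart Act
reachablePart L s₀ = record
  { lts = record
    { State      = [ s ∈ State ∣ Reachable L s₀ s ]
    ; nonempty   = root
    ; _-[_]→_    = λ s α s′ → value s -[ α ]→ value s′
    ; Terminates = λ s → Terminates (value s)
    }
  ; start = root
  }
  where
    open LTS L
    root : [ s ∈ State ∣ Reachable L s₀ s ]
    root = s₀ , [ ε ]

-- The label nothing : Maybe A is the empty step 1; just a is the proper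
-- action a.
induced : {A : Set a} → Chart (Maybe A) → Chart A
induced C = record
  { lts = record
    { State      = State
    ; nonempty   = start
    ; _-[_]→_    = λ s a s′ → ∃ λ sₙ → s ↠₁ sₙ × sₙ -[ just a ]→ s′
    ; Terminates = λ s → ∃ λ sₙ → s ↠₁ sₙ × Terminates sₙ
    }
  ; start = start
  }
  where
    open Chart C
    _↠₁_ : Rel State _
    _↠₁_ = Star (λ s s′ → s -[ nothing ]→ s′)

------------------------------------------------------------------------
-- Bisimulations and partial functions

record IsBisimulation {A : Set a} (C₁ C₂ : Chart A)
                      (B : REL (Chart.State C₁) (Chart.State C₂) ℓ)
                      : Set (a ⊔ ℓ) where
  private
    module C₁ = Chart C₁
    module C₂ = Chart C₂
  field
    start       : B C₁.start C₂.start
    forth       : ∀ {s₁ s₂} → B s₁ s₂ → ∀ {a s₁′} → s₁ C₁.-[ a ]→ s₁′ →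
                  ∃ λ s₂′ → s₂ C₂.-[ a ]→ s₂′ × B s₁′ s₂′
    back        : ∀ {s₁ s₂} → B s₁ s₂ → ∀ {a s₂′} → s₂ C₂.-[ a ]→ s₂′ →
                  ∃ λ s₁′ → s₁ C₁.-[ a ]→ s₁′ × B s₁′ s₂′
    termination : ∀ {s₁ s₂} → B s₁ s₂ → C₁.Terminates s₁ ⇔ C₂.Terminates s₂

-- The domain is an arbitrary subset, not assumed decidable; the value may
-- not depend on the proof of membership in the domain.
record _⇀_ (X Y : Set a) : Set (suc a) where
  field
    dom          : Pred X a
    apply        : ∀ x → dom x → Y
    well-defined : ∀ x (p q : dom x) → apply x p ≡ apply x q

graph : {X Y : Set a} → X ⇀ Y → REL X Y a
graph f x y = Σ[ p ∈ dom x ] apply x p ≡ y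
  where open _⇀_ f

------------------------------------------------------------------------
-- Star expressions and stacked star expressions

-- In the grammar  E ::= e | E · e | E ⋆ e*  an expression e₁ · e₂ arises
-- both from the first and from the second alternative.  The index records
-- whether ⋆ occurs, which lets one constructor _·_ serve both readings, so
-- that no expression has two representations.  E ⋆* e encodes E ⋆ e*.
data Kind : Set where
  plain stacked : Kind

infixl 6 _+_
infixl 7 _·_ _⋆*_
infix  8 _*

data Exp (A : Set a) : Kind → Set a where
  𝟎 𝟏   : Exp A plain
  act   : A → Exp A plain
  _+_   : Exp A plain → Exp A plain → Exp A plain
  _·_   : ∀ {k} → Exp A k → Exp A plain → Exp A k
  _*    : Exp A plain → Exp A plain
  _⋆*_  : ∀ {k} → Exp A k → Exp A plain → Exp A stacked

StExp : Set a → Set a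
StExp A = Exp A plain

StExp⋆ : Set a → Set a
StExp⋆ A = ∃ λ k → Exp A k

module _ {A : Set a} where

  infix 4 _↓ _⟶⟨_⟩_ _⟹⟨_⟩_

  private
    variable
      k k′       : Kind
      b          : A
      α          : Maybe A
      e e₁ e₂ e′ : StExp A
      E          : Exp A k
      E′         : Exp A k′

  -- None of the rules concludes termination of an expression containing ⋆,
  -- so both transition systems share this predicate.
  data _↓ : ∀ {k} → Exp A k → Set a where
    𝟏↓  : 𝟏 ↓
    +↓ˡ : e₁ ↓ → (e₁ + e₂) ↓
    +↓ʳ : e₂ ↓ → (e₁ + e₂) ↓
    ·↓  : e₁ ↓ → e₂ ↓ → (e₁ · e₂) ↓
    *↓  : (e *) ↓

  data _⟶⟨_⟩_ : StExp A → A → StExp A → Set a where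
    act : act b ⟶⟨ b ⟩ 𝟏
    +ˡ  : e₁ ⟶⟨ b ⟩ e′ → e₁ + e₂ ⟶⟨ b ⟩ e′
    +ʳ  : e₂ ⟶⟨ b ⟩ e′ → e₁ + e₂ ⟶⟨ b ⟩ e′
    ·ˡ  : e₁ ⟶⟨ b ⟩ e′ → e₁ · e₂ ⟶⟨ b ⟩ e′ · e₂
    ·ʳ  : e₁ ↓ → e₂ ⟶⟨ b ⟩ e′ → e₁ · e₂ ⟶⟨ b ⟩ e′
    *→  : e ⟶⟨ b ⟩ e′ → e * ⟶⟨ b ⟩ e′ · e *

  data _⟹⟨_⟩_ : ∀ {k k′} → Exp A k → Maybe A → Exp A k′ → Set a where
    act : act b ⟹⟨ just b ⟩ 𝟏
    +ˡ  : e₁ ⟹⟨ just b ⟩ E′ → e₁ + e₂ ⟹⟨ just b ⟩ E′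
    +ʳ  : e₂ ⟹⟨ just b ⟩ E′ → e₁ + e₂ ⟹⟨ just b ⟩ E′
    ·ˡ  : E ⟹⟨ α ⟩ E′ → E · e₂ ⟹⟨ α ⟩ E′ · e₂
    ·ʳ  : e₁ ↓ → e₂ ⟹⟨ just b ⟩ E′ → e₁ · e₂ ⟹⟨ just b ⟩ E′
    *→  : e ⟹⟨ just b ⟩ E′ → e * ⟹⟨ just b ⟩ E′ ⋆* e
    ⋆ˡ  : E ⟹⟨ α ⟩ E′ → E ⋆* e₂ ⟹⟨ α ⟩ E′ ⋆* e₂
    ⋆₁  : e₁ ↓ → e₁ ⋆* e₂ ⟹⟨ nothing ⟩ e₂ *

------------------------------------------------------------------------
-- Interpretations

starLTS : (A : Set a) → LTS A
starLTS A = record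
  { State      = StExp A
  ; nonempty   = 𝟎
  ; _-[_]→_    = _⟶⟨_⟩_
  ; Terminates = _↓
  }

stackedLTS : (A : Set a) → LTS (Maybe A)
stackedLTS A = record
  { State      = StExp⋆ A
  ; nonempty   = plain , 𝟎
  ; _-[_]→_    = λ (_ , E) α (_ , E′) → E ⟹⟨ α ⟩ E′
  ; Terminates = λ (_ , E) → E ↓
  }

chart : StExp A → Chart A
chart e = reachablePart (starLTS _) e

1-chart : StExp A → Chart (Maybe A)
1-chart e = reachablePart (stackedLTS _) (plain , e)

{-# OPTIONS --safe #-}

-- Replacing every ⋆ by · projects stacked star expressions to star
-- expressions.  Along an empty step the projection only loses transitions
-- and termination, and conversely each of them that the projection of E has
-- is matched by E after finitely many empty steps.  The projection does not
-- restrict to a total map between the charts: 1 · a* reaches a* in its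
-- 1-chart but not in its chart.  It is therefore taken on those vertices
-- whose projection is reachable in the chart.
module Submission where

open import Defs
open import Level using (Level)
open import Data.Irrelevant using ([_])
open import Data.Maybe.Base using (just; nothing)
open import Data.Product.Base using (∃; ∃₂; Σ-syntax; _×_; _,_)
open import Data.Refinement using (_,_; value)
open import Data.Refinement.Properties using (value-injective)
open import Function.Base using (id)
open import Function.Bundles using (mk⇔)
open import Relation.Binary.Construct.Closure.ReflexiveTransitive
  using (Star; ε; _◅_; _◅◅_; gmap; map)
open import Relation.Binary.Core using (Rel)
open import Relation.Binary.PropositionalEquality.Core
  using (_≡_; refl; sym; cong; subst)

private
  variable
    a : Level
    A : Set a
    k k′ : Kind
    b : A
    e f g : StExp A
    E : Exp A k
    F : Exp A k′

  infix 4 _↠₁_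

_↠₁_ : Rel (StExp⋆ A) _
_↠₁_ = Star (λ (_ , E) (_ , F) → E ⟹⟨ nothing ⟩ F)

project : Exp A k → StExp A
project 𝟎        = 𝟎
project 𝟏        = 𝟏
project (act b)  = act b
project (e + f)  = e + f
project (E · f)  = project E · f
project (e *)    = e *
project (E ⋆* f) = project E · f *

-- `project` also recurses into plain products, so on star expressions it is the identity only by
-- induction, not by computation.
project-plain : (e : StExp A) → project e ≡ e
project-plain 𝟎       = refl
project-plain 𝟏       = refl
project-plain (act b) = refl
project-plain (e + f) = refl
project-plain (e · f) = cong (_· f) (project-plain e)
project-plain (e *)   = refl

project-↓ : E ↓ → project E ↓
project-↓ 𝟏↓       = 𝟏↓
project-↓ (+↓ˡ p)  = +↓ˡ p
project-↓ (+↓ʳ p)  = +↓ʳ p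
project-↓ (·↓ p q) = ·↓ (project-↓ p) q
project-↓ *↓       = *↓

project-⟹ : E ⟹⟨ just b ⟩ F → project E ⟶⟨ b ⟩ project F
-- `project` leaves summands, right factors and bodies of `*` untouched, so their steps must start
-- from the unprojected source.
plain-⟹   : e ⟹⟨ just b ⟩ F → e ⟶⟨ b ⟩ project F

project-⟹ act      = act
project-⟹ (+ˡ s)   = +ˡ (plain-⟹ s)
project-⟹ (+ʳ s)   = +ʳ (plain-⟹ s)
project-⟹ (·ˡ s)   = ·ˡ (project-⟹ s)
project-⟹ (·ʳ p s) = ·ʳ (project-↓ p) (plain-⟹ s)
project-⟹ (*→ s)   = *→ (plain-⟹ s)
project-⟹ (⋆ˡ s)   = ·ˡ (project-⟹ s)

plain-⟹ {e = e} s = subst (_⟶⟨ _ ⟩ _) (project-plain e) (project-⟹ s)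

-- Every empty step is an instance of `⋆₁` inside left arguments; there `project` gives `e₁ · e₂ *`
-- before and `e₂ *` after, with `e₁` terminating.
reflect-↓-⟹₁ : E ⟹⟨ nothing ⟩ F → project F ↓ → project E ↓
reflect-↓-⟹₁ (·ˡ s) (·↓ p q) = ·↓ (reflect-↓-⟹₁ s p) q
reflect-↓-⟹₁ (⋆ˡ s) (·↓ p q) = ·↓ (reflect-↓-⟹₁ s p) q
reflect-↓-⟹₁ (⋆₁ p) q        = ·↓ (project-↓ p) q

-- At `⋆₁` the rule `·ʳ` passes on the transitions of `e₂ *` with the same target, so `g` is kept
-- exactly. A transition of a right factor survives because termination of the left one is reflected
-- too.
reflect-⟶-⟹₁ : E ⟹⟨ nothing ⟩ F → project F ⟶⟨ b ⟩ g → project E ⟶⟨ b ⟩ g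
reflect-⟶-⟹₁ (·ˡ s) (·ˡ t)   = ·ˡ (reflect-⟶-⟹₁ s t)
reflect-⟶-⟹₁ (·ˡ s) (·ʳ p t) = ·ʳ (reflect-↓-⟹₁ s p) t
reflect-⟶-⟹₁ (⋆ˡ s) (·ˡ t)   = ·ˡ (reflect-⟶-⟹₁ s t)
reflect-⟶-⟹₁ (⋆ˡ s) (·ʳ p t) = ·ʳ (reflect-↓-⟹₁ s p) t
reflect-⟶-⟹₁ (⋆₁ p) t        = ·ʳ (project-↓ p) t

reflect-↓ : (k , E) ↠₁ (k′ , F) → project F ↓ → project E ↓
reflect-↓ ε        p = p
reflect-↓ (s ◅ ss) p = reflect-↓-⟹₁ s (reflect-↓ ss p)

reflect-⟶ : (k , E) ↠₁ (k′ , F) → project F ⟶⟨ b ⟩ g → project E ⟶⟨ b ⟩ g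
reflect-⟶ ε        t = t
reflect-⟶ (s ◅ ss) t = reflect-⟶-⟹₁ s (reflect-⟶ ss t)

-- A plain source needs no empty steps: only the rule for `*` differs, and `project` turns the `⋆*`
-- it creates back into the product.
lift-⟶ : e ⟶⟨ b ⟩ g → ∃₂ λ k (F : Exp _ k) → e ⟹⟨ just b ⟩ F × project F ≡ g
lift-⟶ act = _ , _ , act , refl
lift-⟶ (+ˡ t) with _ , _ , s , eq ← lift-⟶ t = _ , _ , +ˡ s , eq
lift-⟶ (+ʳ t) with _ , _ , s , eq ← lift-⟶ t = _ , _ , +ʳ s , eq
lift-⟶ (·ˡ t) with _ , _ , s , refl ← lift-⟶ t = _ , _ , ·ˡ s , refl
lift-⟶ (·ʳ p t) with _ , _ , s , eq ← lift-⟶ t = _ , _ , ·ʳ p s , eq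
lift-⟶ (*→ t) with _ , _ , s , refl ← lift-⟶ t = _ , _ , *→ s , refl

·-↠₁ : (k , E) ↠₁ (k′ , F) → (k , E · f) ↠₁ (k′ , F · f)
·-↠₁ = gmap (λ (_ , E) → _ , E · _) ·ˡ

⋆-↠₁ : (k , E) ↠₁ (k′ , F) → (stacked , E ⋆* f) ↠₁ (stacked , F ⋆* f)
⋆-↠₁ = gmap (λ (_ , E) → _ , E ⋆* _) ⋆ˡ

-- Empty steps remove each `⋆*` from the inside out. The witness is plain because `·↓`, `·ʳ` and
-- `⋆₁` ask for a plain terminating left argument.
lift-project-↓ : (E : Exp A k) → project E ↓ →
                 ∃ λ e → (k , E) ↠₁ (plain , e) × e ↓
lift-project-↓ 𝟏        p        = _ , ε , p
lift-project-↓ (e + f)  p        = _ , ε , p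
lift-project-↓ (E · f)  (·↓ p q) with _ , ss , r ← lift-project-↓ E p =
  _ , ·-↠₁ ss , ·↓ r q
lift-project-↓ (e *)    p        = _ , ε , p
lift-project-↓ (E ⋆* f) (·↓ p _) with _ , ss , r ← lift-project-↓ E p =
  _ , ⋆-↠₁ ss ◅◅ ⋆₁ r ◅ ε , *↓

lift-project-⟶ : (E : Exp A k) → project E ⟶⟨ b ⟩ g →
  ∃₂ λ k₁ (E₁ : Exp A k₁) → ∃₂ λ k₂ (E₂ : Exp A k₂) →
  (k , E) ↠₁ (k₁ , E₁) × E₁ ⟹⟨ just b ⟩ E₂ × project E₂ ≡ g
lift-project-⟶ (act _) act = _ , _ , _ , _ , ε , act , refl
lift-project-⟶ (e + f) t with _ , _ , s , eq ← lift-⟶ t =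
  _ , _ , _ , _ , ε , s , eq
lift-project-⟶ (E · f) (·ˡ t)
  with _ , _ , _ , _ , ss , s , refl ← lift-project-⟶ E t =
  _ , _ , _ , _ , ·-↠₁ ss , ·ˡ s , refl
lift-project-⟶ (E · f) (·ʳ p t)
  with _ , ss , q ← lift-project-↓ E p | _ , _ , s , eq ← lift-⟶ t =
  _ , _ , _ , _ , ·-↠₁ ss , ·ʳ q s , eq
lift-project-⟶ (e *) t with _ , _ , s , eq ← lift-⟶ t =
  _ , _ , _ , _ , ε , s , eq
lift-project-⟶ (E ⋆* f) (·ˡ t)
  with _ , _ , _ , _ , ss , s , refl ← lift-project-⟶ E t =
  _ , _ , _ , _ , ⋆-↠₁ ss , ⋆ˡ s , refl
-- `⋆*` has no analogue of `·ʳ`: once `E` has become plain and terminating, the empty step `⋆₁`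
-- exposes `f *`, which makes the move.
lift-project-⟶ (E ⋆* f) (·ʳ p t)
  with _ , ss , q ← lift-project-↓ E p | _ , _ , s , eq ← lift-⟶ t =
  _ , _ , _ , _ , ⋆-↠₁ ss ◅◅ ⋆₁ q ◅ ε , s , eq

module _ {Act : Set a} (L : LTS Act) {s₀ : LTS.State L} {α : Act} where
  open LTS L

  reachable-◅◅ : ∀ {s t} → Reachable L s₀ s → Star _-[ α ]→_ s t →
                 Reachable L s₀ t
  reachable-◅◅ r ss = r ◅◅ map (_ ,_) ss

  -- Each vertex on the path is reachable by extending `r`; the differently built proofs at the
  -- endpoint agree by irrelevance.
  reachablePart-Star : ∀ {s t} .(r : Reachable L s₀ s)
    (ss : Star _-[ α ]→_ s t) →
    Star (λ x y → Chart._-[_]→_ (reachablePart L s₀) x α y)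
         (s , [ r ]) (t , [ reachable-◅◅ r ss ])
  reachablePart-Star r ε        = ε
  reachablePart-Star r (s ◅ ss) = s ◅ reachablePart-Star (r ◅◅ (_ , s) ◅ ε) ss

theorem5p9 : ∀ {a : Level} (A : Set a) (e : StExp A) →
    Σ[ f ∈ Chart.State (induced (1-chart e)) ⇀ Chart.State (chart e) ]
    IsBisimulation (induced (1-chart e)) (chart e) (graph f)
theorem5p9 A e = π , record
  { start       = subst (Reachable (starLTS A) e) (sym (project-plain e)) ε
                , value-injective (project-plain e)
  ; forth       = λ { (r , refl) (_ , ss , s) →
      -- `t` serves twice: as the matching transition, and to keep the projection of the target
      -- reachable, hence the target in the domain.
      let t = reflect-⟶ (gmap value id ss) (project-⟹ s)
      in _ , t , r ◅◅ (_ , t) ◅ ε , refl }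
  ; back        = λ { {E , [ q ]} (r , refl) t → back E q r t }
  ; termination = λ { {(_ , E) , [ q ]} (r , refl) → mk⇔
      (λ (_ , ss , p) → reflect-↓ (gmap value id ss) (project-↓ p))
      (λ p → let _ , ss , p′ = lift-project-↓ E p
             in _ , reachablePart-Star (stackedLTS A) q ss , p′) }
  }
  where
  π : Chart.State (induced (1-chart e)) ⇀ Chart.State (chart e)
  π = record
    { dom          = λ ((_ , E) , _) → Reachable (starLTS A) e (project E)
    ; apply        = λ ((_ , E) , _) r → project E , [ r ]
    ; well-defined = λ _ _ _ → refl
    }

  back : ∀ (E : StExp⋆ A) .(q : Reachable (stackedLTS A) (plain , e) E)
    (r : _⇀_.dom π (E , [ q ])) {b g} →
    Chart._-[_]→_ (chart e) (_⇀_.apply π (E , [ q ]) r) b g →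
    ∃ λ F → Chart._-[_]→_ (induced (1-chart e)) (E , [ q ]) b F × graph π F g
  back (_ , E) q r t with _ , _ , _ , _ , ss , s , refl ← lift-project-⟶ E t =
    (_ , [ reachable-◅◅ (stackedLTS A) q ss ◅◅ (_ , s) ◅ ε ])
    , (_ , reachablePart-Star (stackedLTS A) q ss , s)
    -- The witness projects to the target of `t`, so extending `r` by `t` places it in the domain.
    , r ◅◅ (_ , t) ◅ ε , refl
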